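{- Let $\mathcal{P}\subseteq\{0,1\}^{\mathbb{N}}$ be a $\Pi^0_1$ class with $\lambda(\mathcal{P})>0$. Then every Martin-Löf random $Z\in\{0,1\}^{\mathbb{N}}$ is multiply recurrent in $\mathcal{P}$, i.e. for every $k\ge1$ there is $n\ge1$ such that $T^{ni}(Z)\in\mathcal{P}$ for all $1\le i\le k$.
   Context: Cantor space $\{0,1\}^{\mathbb{N}}$ carries the uniform (product) measure $\lambda$. $T$ is the shift, deleting the first bit of a sequence. A $\Sigma^0_1$ class is a set $\{Y:\exists\sigma\in S,\ \sigma\prec Y\}$ for a computably enumerable set $S$ of finite binary strings; a $\Pi^0_1$ class is the complement of a $\Sigma^0_1$ class. A Martin-Löf test is a uniformly computably enumerable sequence $(U_m)_{m\in\mathbb{N}}$ of $\Sigma^0_1$ classes with $\lambda(U_m)\le2^{ -m}$; $Z$ is Martin-Löf random if $Z\notin\bigcap_m U_m$ for every Martin-Löf test. $Z$ is $k$-recurrent in $\mathcal{P}$ if there is $n\ge1$ with $Z\in\bigcap_{1\le i\le k}T^{ -ni}(\mathcal{P})$; multiply recurrent if $k$-recurrent for all $k\ge1$. -}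

module Defs where

open import Data.Nat using (ℕ; zero; suc; _+_; _*_; _∸_; _^_; _≤_; _≡ᵇ_)
open import Data.Bool using (Bool; true; false; if_then_else_; _∨_)
open import Data.List using (List; []; _∷_; [_]; _++_; map; take; length; upTo)
open import Data.Bool.ListAction using (any)
open import Data.Fin using (Fin)
open import Data.Vec using (Vec; []; _∷_; lookup)
open import Data.Product using (∃; _×_)
open import Relation.Binary.PropositionalEquality using (_≡_)
open import Relation.Nullary using (¬_)

-- Computability: primitive recursive functions (codes + evaluation).
-- A set of strings is c.e. iff it is {σ : ∃ s, e(s) = 1 + code σ} for
-- some primitive recursive e (Kleene normal form); uniformly c.e.
-- sequences are given by one primitive recursive e(m, s).

data PR : ℕ → Set where
  zeroF : ∀ {n} → PR n
  succF : PR 1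
  proj  : ∀ {n} → Fin n → PR n
  comp  : ∀ {k n} → PR k → Vec (PR n) k → PR n
  prec  : ∀ {n} → PR n → PR (suc (suc n)) → PR (suc n)

mutual
  ⟦_⟧ : ∀ {n} → PR n → Vec ℕ n → ℕ
  ⟦ zeroF ⟧ xs = 0
  ⟦ succF ⟧ (x ∷ []) = suc x
  ⟦ proj i ⟧ xs = lookup xs i
  ⟦ comp f gs ⟧ xs = ⟦ f ⟧ (evs gs xs)
  ⟦ prec f g ⟧ (y ∷ xs) = iter f g y xs

  evs : ∀ {k n} → Vec (PR n) k → Vec ℕ n → Vec ℕ k
  evs [] xs = []
  evs (g ∷ gs) xs = ⟦ g ⟧ xs ∷ evs gs xs

  iter : ∀ {n} → PR n → PR (suc (suc n)) → ℕ → Vec ℕ n → ℕ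
  iter f g zero xs = ⟦ f ⟧ xs
  iter f g (suc y) xs = ⟦ g ⟧ (y ∷ iter f g y xs ∷ xs)

Cantor : Set
Cantor = ℕ → Bool

-- strings: first list element = first bit
code : List Bool → ℕ
code [] = 0
code (false ∷ σ) = 1 + 2 * code σ
code (true ∷ σ) = 2 + 2 * code σ

prefix : ℕ → Cantor → List Bool
prefix zero Y = []
prefix (suc n) Y = Y 0 ∷ prefix n (λ x → Y (suc x))

shift : ℕ → Cantor → Cantor
shift j Z = λ x → Z (j + x)

-- Σ⁰₁ classes given by an enumeration e : ℕ → ℕ
-- (stage s enumerates the string σ iff e s = suc (code σ)).

InOpen : (ℕ → ℕ) → Cantor → Set
InOpen e Y = ∃ λ s → ∃ λ n → e s ≡ suc (code (prefix n Y))

allStrings : ℕ → List (List Bool)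
allStrings zero = [ [] ]
allStrings (suc L) = map (false ∷_) (allStrings L) ++ map (true ∷_) (allStrings L)

hit : (ℕ → ℕ) → ℕ → List Bool → Bool
hit e s τ = any (λ i → any (λ j → e i ≡ᵇ suc (code (take j τ))) (upTo (suc (length τ)))) (upTo s)

countTrue : List Bool → ℕ
countTrue [] = 0
countTrue (b ∷ bs) = (if b then 1 else 0) + countTrue bs

-- approx e s L / 2^L = measure of the union of the cylinders of the
-- strings enumerated before stage s, computed at resolution L.
-- λ(open set of e) = sup over s, L of approx e s L / 2^L.
approx : (ℕ → ℕ) → ℕ → ℕ → ℕ
approx e s L = countTrue (map (hit e s) (allStrings L))

MeasureLE2^- : (ℕ → ℕ) → ℕ → Set
MeasureLE2^- e m = ∀ s L → approx e s L * 2 ^ m ≤ 2 ^ L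

enumΠ : PR 1 → ℕ → ℕ
enumΠ p s = ⟦ p ⟧ (s ∷ [])

InΠ01 : PR 1 → Cantor → Set
InΠ01 p Y = ¬ InOpen (enumΠ p) Y

-- λ(P) > 0, i.e. λ(complement) < 1, i.e. for some r,
-- λ(complement) ≤ 1 - 2^-r.
PositiveMeasureΠ01 : PR 1 → Set
PositiveMeasureΠ01 p =
  ∃ λ r → ∀ s L → approx (enumΠ p) s L * 2 ^ r ≤ (2 ^ r ∸ 1) * 2 ^ L

level : PR 2 → ℕ → ℕ → ℕ
level t m s = ⟦ t ⟧ (m ∷ s ∷ [])

IsMLTest : PR 2 → Set
IsMLTest t = ∀ m → MeasureLE2^- (level t m) m

MLRandom : Cantor → Set
MLRandom Z = ∀ (t : PR 2) → IsMLTest t → ¬ (∀ m → InOpen (level t m) Z)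

Recurrent : ℕ → PR 1 → Cantor → Set
Recurrent k p Z = ∃ λ n → 1 ≤ n × (∀ i → 1 ≤ i → i ≤ k → InΠ01 p (shift (n * i) Z))

MultiplyRecurrent : PR 1 → Cantor → Set
MultiplyRecurrent p Z = ∀ k → 1 ≤ k → Recurrent k p Z

{-# OPTIONS --safe #-}
-- Let Q be the complement of P and C_a the set of Y with T^{ai}(Y) ∈ Q for some 1 ≤ i ≤ k.
-- Up to measure ε, Q is a clopen set, for which the conditions at a, 2a, …, ka concern disjoint
-- blocks of bits once a is large; hence there are N and n₀ with λ(C_a) ≤ 1 - 1/N for all a ≥ n₀.
-- If Z is not k-recurrent then Z ∈ C_a for every a ≥ 1.  Read Z bit by bit, starting with the
-- anchor a = n₀; as soon as some prefix of length ℓ shows Z ∈ C_a, replace the anchor by ℓ.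
-- C_ℓ only depends on the bits from ℓ on, so each replacement costs a factor 1 - 1/N in measure,
-- and "at least N m replacements" is a Σ⁰₁ event of measure ≤ (1 - 1/N)^{Nm} ≤ 2^{-m},
-- uniformly in m.  N and n₀ are not computed from P, but a test only needs them as constants.
module Submission where

open import Defs
open import Level using (0ℓ)
open import Axiom.ExcludedMiddle using (ExcludedMiddle)
open import Data.Bool using (Bool; true; false; T; if_then_else_)
open import Data.Fin as Fin using (Fin)
open import Data.Fin.Patterns using (0F; 1F; 2F; 3F; 4F)
open import Data.List using (List; []; _∷_; _++_; _∷ʳ_; take; drop; length; map; upTo)
open import Data.List.Membership.Propositional using (lose; find)
open import Data.List.Membership.Propositional.Properties using (∈-upTo⁺; ∈-upTo⁻)
open import Data.List.Properties
  using (∷ʳ-++; ++-identityʳ; drop-all; drop-drop; length-++; length-take; map-++; map-∘; take++drop≡id; take-all; take-take)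
open import Data.List.Relation.Unary.Any.Properties using (any⁺; any⁻)
open import Data.Nat
  using (ℕ; zero; suc; pred; _+_; _*_; _∸_; _^_; _⊔_; _⊓_; _≤_; _<_; z≤n; s≤s; s≤s⁻¹; NonZero; >-nonZero)
open import Data.Nat.Properties
open import Data.Nat.Tactic.RingSolver using (solve-∀)
open import Data.Product using (∃; ∃₂; _×_; _,_; proj₂)
open import Data.Sum using (inj₁; inj₂)
open import Data.Vec using (Vec; []; _∷_; lookup; tabulate)
open import Data.Vec.Properties using (tabulate∘lookup)
open import Function using (_∘_; _$_)
open import Relation.Binary.PropositionalEquality hiding (J)
open import Relation.Nullary using (¬_; contradiction; yes; no)

-- Closure properties of primitive recursive functions

record PrimRec {n} (f : Vec ℕ n → ℕ) : Set where
  constructor _realises_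
  field
    program : PR n
    correct : ∀ xs → ⟦ program ⟧ xs ≡ f xs
open PrimRec

-- Records rather than abbreviations, so that `f` can be inferred from the type; unification could
-- not recover it from its composite with `lookup`.
record PrimRec₁ (f : ℕ → ℕ) : Set where
  constructor unary
  field vector : PrimRec {1} λ xs → f (lookup xs 0F)

record PrimRec₂ (f : ℕ → ℕ → ℕ) : Set where
  constructor binary
  field vector : PrimRec {2} λ xs → f (lookup xs 0F) (lookup xs 1F)

record PrimRec₃ (f : ℕ → ℕ → ℕ → ℕ) : Set where
  constructor ternary
  field vector : PrimRec {3} λ xs → f (lookup xs 0F) (lookup xs 1F) (lookup xs 2F)

primRec-resp : ∀ {n} {f g : Vec ℕ n → ℕ} → (∀ xs → f xs ≡ g xs) → PrimRec f → PrimRec g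
primRec-resp f≗g (c realises ok) = c realises λ xs → trans (ok xs) (f≗g xs)

var : ∀ {n} (i : Fin n) → PrimRec (λ xs → lookup xs i)
var i = proj i realises λ _ → refl

app₁ : ∀ {n f} {g : Vec ℕ n → ℕ} → PrimRec₁ f → PrimRec g → PrimRec (λ xs → f (g xs))
app₁ {f = f} (unary (c realises ok)) (d realises ok′) =
  comp c (d ∷ []) realises λ xs → trans (ok _) (cong f (ok′ xs))

app₂ : ∀ {n f} {g h : Vec ℕ n → ℕ} → PrimRec₂ f → PrimRec g → PrimRec h →
  PrimRec (λ xs → f (g xs) (h xs))
app₂ {f = f} (binary (c realises ok)) (d realises ok′) (d′ realises ok″) =
  comp c (d ∷ d′ ∷ []) realises λ xs → trans (ok _) (cong₂ f (ok′ xs) (ok″ xs))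

app₃ : ∀ {n f} {g h k : Vec ℕ n → ℕ} → PrimRec₃ f → PrimRec g → PrimRec h → PrimRec k →
  PrimRec (λ xs → f (g xs) (h xs) (k xs))
app₃ {f = f} {k = k} (ternary (c realises ok)) (d realises ok′) (d′ realises ok″) (d″ realises ok‴) =
  comp c (d ∷ d′ ∷ d″ ∷ []) realises λ xs →
    trans (ok _) (trans (cong₂ (λ u v → f u v _) (ok′ xs) (ok″ xs)) (cong (f _ _) (ok‴ xs)))

suc-primRec : PrimRec₁ suc
suc-primRec = unary $ succF realises λ { (_ ∷ []) → refl }

const-primRec : ∀ {n} c → PrimRec {n} (λ _ → c)
const-primRec zero = zeroF realises λ _ → refl
const-primRec (suc c) = app₁ suc-primRec (const-primRec c)

evs-tabulate : ∀ {n m} (f : Fin m → Fin n) (xs : Vec ℕ n) →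
  evs (tabulate (λ i → proj (f i))) xs ≡ tabulate (λ i → lookup xs (f i))
evs-tabulate {m = zero} f xs = refl
evs-tabulate {m = suc m} f xs = cong (lookup xs (f 0F) ∷_) (evs-tabulate (f ∘ Fin.suc) xs)

rec : ℕ → (ℕ → ℕ → ℕ) → ℕ → ℕ
rec z s zero = z
rec z s (suc y) = s y (rec z s y)

rec-primRec : ∀ {n} {z b : Vec ℕ n → ℕ} {s : Vec ℕ (suc (suc n)) → ℕ} →
  PrimRec z → PrimRec s → PrimRec b →
  PrimRec (λ xs → rec (z xs) (λ y r → s (y ∷ r ∷ xs)) (b xs))
rec-primRec {n} {z} {b} {s} (c realises ok) (d realises ok′) (b′ realises ok″) =
  -- `b′` computes the number of iterations; `tabulate proj` hands the parameters on unchanged.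
  comp (prec c d) (b′ ∷ tabulate proj) realises λ xs →
    trans (cong₂ (iter c d) (ok″ xs) (trans (evs-tabulate (λ i → i) xs) (tabulate∘lookup xs)))
          (iter≡rec (b xs) xs)
  where
  iter≡rec : ∀ y xs → iter c d y xs ≡ rec (z xs) (λ y r → s (y ∷ r ∷ xs)) y
  iter≡rec zero xs = ok xs
  iter≡rec (suc y) xs =
    trans (ok′ _) (cong (λ r → s (y ∷ r ∷ xs)) (iter≡rec y xs))

+-primRec : PrimRec₂ _+_
+-primRec = binary $ primRec-resp (λ xs → eq (lookup xs 0F) (lookup xs 1F))
  (rec-primRec (var 1F) (app₁ suc-primRec (var 1F)) (var 0F))
  where
  eq : ∀ x y → rec y (λ _ r → suc r) x ≡ x + y
  eq zero y = refl
  eq (suc x) y = cong suc (eq x y)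

*-primRec : PrimRec₂ _*_
*-primRec = binary $ primRec-resp (λ xs → eq (lookup xs 0F) (lookup xs 1F))
  (rec-primRec (const-primRec 0) (app₂ +-primRec (var 3F) (var 1F)) (var 0F))
  where
  eq : ∀ x y → rec 0 (λ _ r → y + r) x ≡ x * y
  eq zero y = refl
  eq (suc x) y = cong (y +_) (eq x y)

pred-primRec : PrimRec₁ pred
pred-primRec = unary $ primRec-resp (λ xs → eq (lookup xs 0F))
  (rec-primRec (const-primRec 0) (var 0F) (var 0F))
  where
  eq : ∀ x → rec 0 (λ y _ → y) x ≡ pred x
  eq zero = refl
  eq (suc x) = refl

∸-primRec : PrimRec₂ _∸_
∸-primRec = binary $ primRec-resp (λ xs → eq (lookup xs 0F) (lookup xs 1F))
  (rec-primRec (var 0F) (app₁ pred-primRec (var 1F)) (var 1F))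
  where
  eq : ∀ x y → rec x (λ _ r → pred r) y ≡ x ∸ y
  eq x zero = refl
  eq x (suc y) = trans (cong pred (eq x y)) (pred[m∸n]≡m∸[1+n] x y)

2^-primRec : PrimRec₁ (2 ^_)
2^-primRec = unary $ primRec-resp (λ xs → eq (lookup xs 0F))
  (rec-primRec (const-primRec 1) (app₂ *-primRec (const-primRec 2) (var 1F)) (var 0F))
  where
  eq : ∀ y → rec 1 (λ _ r → 2 * r) y ≡ 2 ^ y
  eq zero = refl
  eq (suc y) = cong (2 *_) (eq y)

cond : ∀ {A : Set} → ℕ → A → A → A
cond zero t f = f
cond (suc _) t f = t

cond-primRec : PrimRec₃ cond
cond-primRec = ternary $ primRec-resp (λ xs → eq (lookup xs 0F) (lookup xs 1F) (lookup xs 2F))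
  (rec-primRec (var 2F) (var 3F) (var 0F))
  where
  eq : ∀ c t f → rec f (λ _ _ → t) c ≡ cond c t f
  eq zero t f = refl
  eq (suc c) t f = refl

sumTo : (ℕ → ℕ) → ℕ → ℕ
sumTo f zero = 0
sumTo f (suc n) = sumTo f n + f n

sumTo-primRec : ∀ {n} {f : Vec ℕ (suc n) → ℕ} {b : Vec ℕ n → ℕ} → PrimRec f → PrimRec b →
  PrimRec (λ xs → sumTo (λ i → f (i ∷ xs)) (b xs))
sumTo-primRec {n} {f} {b} (c realises ok) pb =
  primRec-resp (λ xs → eq (λ i → f (i ∷ xs)) (b xs))
    (rec-primRec (const-primRec 0)
      (app₂ +-primRec (var 1F) weakened) pb)
  where
  -- The recursion step also receives the accumulated sum, which the summand has to skip.
  weakened : PrimRec {suc (suc n)} (λ { (y ∷ _ ∷ xs) → f (y ∷ xs) })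
  weakened = comp c (proj 0F ∷ tabulate (λ i → proj (Fin.suc (Fin.suc i)))) realises λ where
    (y ∷ r ∷ xs) → trans (ok _) (cong (λ v → f (y ∷ v))
      (trans (evs-tabulate (λ i → Fin.suc (Fin.suc i)) (y ∷ r ∷ xs)) (tabulate∘lookup xs)))
  eq : ∀ (g : ℕ → ℕ) m → rec 0 (λ y r → r + g y) m ≡ sumTo g m
  eq g zero = refl
  eq g (suc m) = cong (_+ g m) (eq g m)

sumTo>0 : ∀ f {n} i → i < n → 0 < f i → 0 < sumTo f n
sumTo>0 f {suc n} i i<1+n 0<fi with m≤n⇒m<n∨m≡n (s≤s⁻¹ i<1+n)
... | inj₁ i<n = ≤-trans (sumTo>0 f i i<n 0<fi) (m≤m+n _ _)
... | inj₂ refl = ≤-trans 0<fi (m≤n+m _ _)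

sumTo>0⁻¹ : ∀ f n → 0 < sumTo f n → ∃ λ i → i < n × 0 < f i
sumTo>0⁻¹ f (suc n) pos with sumTo f n in eq
... | zero = n , ≤-refl , pos
... | suc _ with i , i<n , 0<fi ← sumTo>0⁻¹ f n (subst (0 <_) (sym eq) (s≤s z≤n)) =
  i , m<n⇒m<1+n i<n , 0<fi

f≤sumTo : ∀ f {n} i → i < n → f i ≤ sumTo f n
f≤sumTo f {suc n} i i<1+n with m≤n⇒m<n∨m≡n (s≤s⁻¹ i<1+n)
... | inj₁ i<n = ≤-trans (f≤sumTo f i i<n) (m≤m+n _ _)
... | inj₂ refl = m≤n+m _ _

-- Operations on codes of strings

-- tail# (1 + 2c) = tail# (2 + 2c) = c, so the values at n and n + 1 add up to n - 1.
tail# : ℕ → ℕ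
tail# zero = 0
tail# (suc n) = pred n ∸ tail# n

drop# : ℕ → ℕ → ℕ
drop# zero x = x
drop# (suc j) x = tail# (drop# j x)

take# : ℕ → ℕ → ℕ
take# j x = x ∸ 2 ^ j * drop# j x

-- Counts the j for which something is left after dropping j bits; j < `x` suffices because no
-- string is longer than its code.
length# : ℕ → ℕ
length# x = sumTo (λ j → cond (drop# j x) 1 0) x

eq# : ℕ → ℕ → ℕ
eq# x y = 1 ∸ ((x ∸ y) + (y ∸ x))

tail#-primRec : PrimRec₁ tail#
tail#-primRec = unary $ primRec-resp (λ xs → eq (lookup xs 0F))
  (rec-primRec (const-primRec 0)
    (app₂ ∸-primRec (app₁ pred-primRec (var 0F)) (var 1F)) (var 0F))
  where
  eq : ∀ x → rec 0 (λ y r → pred y ∸ r) x ≡ tail# x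
  eq zero = refl
  eq (suc x) = cong (pred x ∸_) (eq x)

drop#-primRec : PrimRec₂ drop#
drop#-primRec = binary $ primRec-resp (λ xs → eq (lookup xs 0F) (lookup xs 1F))
  (rec-primRec (var 1F) (app₁ tail#-primRec (var 1F)) (var 0F))
  where
  eq : ∀ j x → rec x (λ _ r → tail# r) j ≡ drop# j x
  eq zero x = refl
  eq (suc j) x = cong tail# (eq j x)

take#-primRec : PrimRec₂ take#
take#-primRec = binary $ app₂ ∸-primRec (var 1F)
  (app₂ *-primRec (app₁ 2^-primRec (var 0F)) (app₂ drop#-primRec (var 0F) (var 1F)))

length#-primRec : PrimRec₁ length#
length#-primRec = unary $ sumTo-primRec
  (app₃ cond-primRec (app₂ drop#-primRec (var 0F) (var 1F)) (const-primRec 1) (const-primRec 0))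
  (var 0F)

eq#-primRec : PrimRec₂ eq#
eq#-primRec = binary $ app₂ ∸-primRec (const-primRec 1)
  (app₂ +-primRec (app₂ ∸-primRec (var 0F) (var 1F)) (app₂ ∸-primRec (var 1F) (var 0F)))

eq#-refl : ∀ {x y} → x ≡ y → 0 < eq# x y
eq#-refl {x} refl rewrite n∸n≡0 x = s≤s z≤n

eq#⇒≡ : ∀ {x y} → 0 < eq# x y → x ≡ y
eq#⇒≡ {zero} {zero} _ = refl
eq#⇒≡ {zero} {suc y} pos = contradiction (subst (0 <_) (0∸n≡0 y) pos) λ ()
eq#⇒≡ {suc x} {zero} pos = contradiction (subst (0 <_) (0∸n≡0 (x + 0)) pos) λ ()
eq#⇒≡ {suc x} {suc y} pos = cong suc (eq#⇒≡ pos)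

tail#-odd : ∀ c → tail# (1 + 2 * c) ≡ c
tail#-even : ∀ c → tail# (2 + 2 * c) ≡ c
tail#-odd zero = refl
tail#-odd (suc c) rewrite +-suc c (c + 0) | tail#-even c = trans (cong (_∸ c) lem) (m+n∸m≡n c (suc c))
  where
  lem : suc (c + (c + 0)) ≡ c + suc c
  lem = trans (cong suc (cong (c +_) (+-identityʳ c))) (sym (+-suc c c))
tail#-even c rewrite tail#-odd c = trans (m+n∸m≡n c (c + 0)) (+-identityʳ c)

tail#-code : ∀ σ → tail# (code σ) ≡ code (drop 1 σ)
tail#-code [] = refl
tail#-code (false ∷ σ) = tail#-odd (code σ)
tail#-code (true ∷ σ) = tail#-even (code σ)

drop#-code : ∀ j σ → drop# j (code σ) ≡ code (drop j σ)
drop#-code zero σ = refl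
drop#-code (suc j) σ = begin
  tail# (drop# j (code σ)) ≡⟨ cong tail# (drop#-code j σ) ⟩
  tail# (code (drop j σ))  ≡⟨ tail#-code (drop j σ) ⟩
  code (drop 1 (drop j σ)) ≡⟨ cong code (drop-drop j 1 σ) ⟩
  code (drop (j + 1) σ)    ≡⟨ cong (λ n → code (drop n σ)) (+-comm j 1) ⟩
  code (drop (suc j) σ)    ∎
  where open ≡-Reasoning

-- `code` is bijective base 2 with digits 1 and 2, the first bit being the least significant digit.
-- Hence `take#` can be a subtraction.
code-take-drop : ∀ j σ → code σ ≡ code (take j σ) + 2 ^ j * code (drop j σ)
code-take-drop zero σ = sym (+-identityʳ (code σ))
code-take-drop (suc j) [] = sym (*-zeroʳ (2 ^ suc j))
code-take-drop (suc j) (false ∷ σ) rewrite code-take-drop j σ =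
  lem (code (take j σ)) (2 ^ j) (code (drop j σ))
  where
  lem : ∀ a p b → 1 + 2 * (a + p * b) ≡ 1 + 2 * a + 2 * p * b
  lem = solve-∀
code-take-drop (suc j) (true ∷ σ) rewrite code-take-drop j σ =
  lem (code (take j σ)) (2 ^ j) (code (drop j σ))
  where
  lem : ∀ a p b → 2 + 2 * (a + p * b) ≡ 2 + 2 * a + 2 * p * b
  lem = solve-∀

take#-code : ∀ j σ → take# j (code σ) ≡ code (take j σ)
take#-code j σ = begin
  code σ ∸ 2 ^ j * drop# j (code σ)
    ≡⟨ cong₂ (λ u v → u ∸ 2 ^ j * v) (code-take-drop j σ) (drop#-code j σ) ⟩
  code (take j σ) + 2 ^ j * code (drop j σ) ∸ 2 ^ j * code (drop j σ)
    ≡⟨ m+n∸n≡m _ (2 ^ j * code (drop j σ)) ⟩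
  code (take j σ) ∎
  where open ≡-Reasoning

length≤code : ∀ σ → length σ ≤ code σ
length≤code [] = z≤n
length≤code (false ∷ σ) = s≤s (≤-trans (length≤code σ) (m≤m+n _ _))
length≤code (true ∷ σ) = s≤s (≤-trans (length≤code σ) (≤-trans (m≤m+n _ _) (n≤1+n _)))

length#-code : ∀ σ → length# (code σ) ≡ length σ
length#-code σ = go (code σ) (length≤code σ)
  where
  bit : ℕ → ℕ
  bit j = cond (drop# j (code σ)) 1 0
  bit-in : ∀ j τ → j < length τ → cond (code (drop j τ)) 1 0 ≡ 1
  bit-in zero (false ∷ τ) _ = refl
  bit-in zero (true ∷ τ) _ = refl
  bit-in (suc j) (_ ∷ τ) (s≤s j<) = bit-in j τ j<
  below : ∀ n → n ≤ length σ → sumTo bit n ≡ n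
  below zero _ = refl
  below (suc n) n< rewrite below n (<⇒≤ n<) | drop#-code n σ | bit-in n σ n< = +-comm n 1
  go : ∀ n → length σ ≤ n → sumTo bit n ≡ length σ
  go zero le = sym (n≤0⇒n≡0 le)
  go (suc n) le with m≤n⇒m<n∨m≡n le
  ... | inj₂ eq = trans (below (suc n) (≤-reflexive (sym eq))) (sym eq)
  ... | inj₁ (s≤s l≤n) rewrite go n l≤n | drop#-code n σ | drop-all n σ l≤n = +-identityʳ _

-- Integration over strings of fixed length

-- 2^`L` times the mean of `f` over `L` fair coin tosses; without normalisation all measure
-- estimates stay in ℕ.
∫ : ℕ → (List Bool → ℕ) → ℕ
∫ zero f = f []
∫ (suc L) f = ∫ L (f ∘ (false ∷_)) + ∫ L (f ∘ (true ∷_))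

∫-mono : ∀ L {f g} → (∀ τ → length τ ≡ L → f τ ≤ g τ) → ∫ L f ≤ ∫ L g
∫-mono zero f≤g = f≤g [] refl
∫-mono (suc L) f≤g = +-mono-≤ (∫-mono L λ τ eq → f≤g (false ∷ τ) (cong suc eq))
                              (∫-mono L λ τ eq → f≤g (true ∷ τ) (cong suc eq))

∫-cong : ∀ L {f g} → (∀ τ → length τ ≡ L → f τ ≡ g τ) → ∫ L f ≡ ∫ L g
∫-cong zero f≡g = f≡g [] refl
∫-cong (suc L) f≡g = cong₂ _+_ (∫-cong L λ τ eq → f≡g (false ∷ τ) (cong suc eq))
                               (∫-cong L λ τ eq → f≡g (true ∷ τ) (cong suc eq))

∫-+ : ∀ L f g → ∫ L (λ τ → f τ + g τ) ≡ ∫ L f + ∫ L g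
∫-+ zero f g = refl
∫-+ (suc L) f g
  rewrite ∫-+ L (f ∘ (false ∷_)) (g ∘ (false ∷_)) | ∫-+ L (f ∘ (true ∷_)) (g ∘ (true ∷_)) =
  interchange (∫ L (f ∘ (false ∷_))) _ _ _
  where
  interchange : ∀ a b c d → a + b + (c + d) ≡ a + c + (b + d)
  interchange = solve-∀

∫-*ˡ : ∀ L c f → ∫ L (λ τ → c * f τ) ≡ c * ∫ L f
∫-*ˡ zero c f = refl
∫-*ˡ (suc L) c f = trans (cong₂ _+_ (∫-*ˡ L c _) (∫-*ˡ L c _)) (sym (*-distribˡ-+ c _ _))

∫-const : ∀ L c → ∫ L (λ _ → c) ≡ c * 2 ^ L
∫-const zero c = sym (*-identityʳ c)
∫-const (suc L) c = trans (cong₂ _+_ (∫-const L c) (∫-const L c)) (double c (2 ^ L))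
  where
  double : ∀ c p → c * p + c * p ≡ c * (2 * p)
  double = solve-∀

∫-1 : ∀ L → ∫ L (λ _ → 1) ≡ 2 ^ L
∫-1 L = trans (∫-const L 1) (+-identityʳ _)

∫-drop : ∀ a L g → ∫ (a + L) (g ∘ drop a) ≡ 2 ^ a * ∫ L g
∫-drop zero L g = sym (+-identityʳ _)
∫-drop (suc a) L g = trans (cong₂ _+_ (∫-drop a L g) (∫-drop a L g)) (double (2 ^ a) (∫ L g))
  where
  double : ∀ p x → p * x + p * x ≡ 2 * p * x
  double = solve-∀

-- Fubini for independent factors: `f` reads only the first `a` bits, `g` only the bits after them.
∫-independent : ∀ a L f g → (∀ σ ρ → length σ ≡ a → f (σ ++ ρ) ≡ f σ) →
  ∫ (a + L) (λ τ → f τ * g (drop a τ)) ≡ ∫ a f * ∫ L g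
∫-independent zero L f g local =
  trans (∫-cong L λ τ _ → cong (_* g τ) (local [] τ refl)) (∫-*ˡ L (f []) g)
∫-independent (suc a) L f g local = trans
  (cong₂ _+_ (∫-independent a L (f ∘ (false ∷_)) g λ σ ρ eq → local (false ∷ σ) ρ (cong suc eq))
             (∫-independent a L (f ∘ (true ∷_)) g λ σ ρ eq → local (true ∷ σ) ρ (cong suc eq)))
  (sym (*-distribʳ-+ (∫ L g) (∫ a (f ∘ (false ∷_))) (∫ a (f ∘ (true ∷_)))))

-- Each of the 2^`M` extensions of a string has at least its value. This compares measures at
-- different resolutions.
∫-extend : ∀ L M f → (∀ σ ρ → f σ ≤ f (σ ++ ρ)) → ∫ L f * 2 ^ M ≤ ∫ (L + M) f
∫-extend zero M f mono = ≤-trans (≤-reflexive (sym (∫-const M (f [])))) (∫-mono M λ τ _ → mono [] τ)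
∫-extend (suc L) M f mono = ≤-trans
  (≤-reflexive (*-distribʳ-+ (2 ^ M) (∫ L (f ∘ (false ∷_))) (∫ L (f ∘ (true ∷_)))))
  (+-mono-≤ (∫-extend L M (f ∘ (false ∷_)) λ σ ρ → mono (false ∷ σ) ρ)
            (∫-extend L M (f ∘ (true ∷_)) λ σ ρ → mono (true ∷ σ) ρ))

∫≤2^ : ∀ L f → (∀ τ → f τ ≤ 1) → ∫ L f ≤ 2 ^ L
∫≤2^ L f f≤1 = ≤-trans (∫-mono L λ τ _ → f≤1 τ) (≤-reflexive (∫-1 L))

∫-complement : ∀ L f → (∀ τ → f τ ≤ 1) → ∫ L (λ τ → 1 ∸ f τ) + ∫ L f ≡ 2 ^ L
∫-complement L f f≤1 = trans (sym (∫-+ L _ f))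
  (trans (∫-cong L λ τ _ → m∸n+n≡m (f≤1 τ)) (∫-1 L))

-- Counting as integration, and complementary measures

countTrue-++ : ∀ bs cs → countTrue (bs ++ cs) ≡ countTrue bs + countTrue cs
countTrue-++ [] cs = refl
countTrue-++ (b ∷ bs) cs rewrite countTrue-++ bs cs = sym (+-assoc (if b then 1 else 0) _ _)

indicator : (List Bool → Bool) → List Bool → ℕ
indicator p τ = if p τ then 1 else 0

countTrue≡∫ : ∀ L p → countTrue (map p (allStrings L)) ≡ ∫ L (indicator p)
countTrue≡∫ zero p = +-identityʳ _
countTrue≡∫ (suc L) p
  rewrite map-++ p (map (false ∷_) (allStrings L)) (map (true ∷_) (allStrings L))
        | countTrue-++ (map p (map (false ∷_) (allStrings L))) (map p (map (true ∷_) (allStrings L)))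
        | sym (map-∘ {g = p} {f = false ∷_} (allStrings L))
        | sym (map-∘ {g = p} {f = true ∷_} (allStrings L)) =
  cong₂ _+_ (countTrue≡∫ L (p ∘ (false ∷_))) (countTrue≡∫ L (p ∘ (true ∷_)))

drop-++ : ∀ {A : Set} n (xs ys : List A) → drop n (xs ++ ys) ≡ drop n xs ++ drop (n ∸ length xs) ys
drop-++ zero [] ys = refl
drop-++ zero (x ∷ xs) ys = refl
drop-++ (suc n) [] ys = refl
drop-++ (suc n) (x ∷ xs) ys = drop-++ n xs ys

take-++-≤ : ∀ {A : Set} n (xs ys : List A) → n ≤ length xs → take n (xs ++ ys) ≡ take n xs
take-++-≤ zero xs ys _ = refl
take-++-≤ (suc n) (x ∷ xs) ys (s≤s n≤) = cong (x ∷_) (take-++-≤ n xs ys n≤)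

-- For complementary parts `c` and `g` of `t`, the bounds c/t ≤ x/(1+x) and g/t ≥ 1/(1+x) are
-- equivalent; `complement-upper` is the other direction.
complement-lower : ∀ {c g t} x → c + g ≡ t → c * suc x ≤ x * t → t ≤ g * suc x
complement-lower {c} {g} x refl le = +-cancelˡ-≤ (x * (c + g)) _ _ (begin
  x * (c + g) + (c + g) ≡⟨ expand x c g ⟩
  c * suc x + g * suc x ≤⟨ +-monoˡ-≤ (g * suc x) le ⟩
  x * (c + g) + g * suc x ∎)
  where
  open ≤-Reasoning
  expand : ∀ x c g → x * (c + g) + (c + g) ≡ c * suc x + g * suc x
  expand = solve-∀

complement-upper : ∀ {c g t} x → c + g ≡ t → t ≤ g * suc x → c * suc x ≤ x * t
complement-upper {c} {g} x refl le = +-cancelʳ-≤ (c + g) _ _ (begin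
  c * suc x + (c + g) ≤⟨ +-monoʳ-≤ (c * suc x) le ⟩
  c * suc x + g * suc x ≡⟨ expand x c g ⟩
  x * (c + g) + (c + g) ∎)
  where
  open ≤-Reasoning
  expand : ∀ x c g → c * suc x + g * suc x ≡ x * (c + g) + (c + g)
  expand = solve-∀

-- Finite stages of an enumerated open set

module Enumeration (e : ℕ → ℕ) where

  Hits : ℕ → List Bool → Set
  Hits s τ = ∃₂ λ i j → i < s × j ≤ length τ × e i ≡ suc (code (take j τ))

  hit⇒Hits : ∀ s τ → T (hit e s τ) → Hits s τ
  hit⇒Hits s τ h
    with i , i∈ , hᵢ ← find (any⁻ _ (upTo s) h)
    with j , j∈ , hⱼ ← find (any⁻ _ (upTo (suc (length τ))) hᵢ) =
    i , j , ∈-upTo⁻ i∈ , s≤s⁻¹ (∈-upTo⁻ j∈) , ≡ᵇ⇒≡ _ _ hⱼ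

  Hits⇒hit : ∀ s τ → Hits s τ → T (hit e s τ)
  Hits⇒hit s τ (i , j , i<s , j≤ , eq) =
    any⁺ _ (lose (∈-upTo⁺ i<s) (any⁺ _ (lose (∈-upTo⁺ (s≤s j≤)) (≡⇒≡ᵇ _ _ eq))))

  Hits-mono : ∀ {s s′} σ ρ → s ≤ s′ → Hits s σ → Hits s′ (σ ++ ρ)
  Hits-mono σ ρ s≤s′ (i , j , i<s , j≤ , eq) =
    i , j , ≤-trans i<s s≤s′
    , ≤-trans j≤ (≤-trans (m≤m+n _ _) (≤-reflexive (sym (length-++ σ))))
    , trans eq (cong (suc ∘ code) (sym (take-++-≤ j σ ρ j≤)))

  χ : ℕ → List Bool → ℕ
  χ s = indicator (hit e s)

  χᶜ : ℕ → List Bool → ℕ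
  χᶜ s τ = 1 ∸ χ s τ

  data χView (s : ℕ) (τ : List Bool) : ℕ → Set where
    inside  : Hits s τ → χView s τ 1
    outside : ¬ Hits s τ → χView s τ 0

  χ-view : ∀ s τ → χView s τ (χ s τ)
  χ-view s τ with hit e s τ in eq
  ... | true  = inside (hit⇒Hits s τ (subst T (sym eq) _))
  ... | false = outside λ h → subst T eq (Hits⇒hit s τ h)

  χ≤1 : ∀ s τ → χ s τ ≤ 1
  χ≤1 s τ with hit e s τ
  ... | true = ≤-refl
  ... | false = z≤n

  χᶜ≤1 : ∀ s τ → χᶜ s τ ≤ 1
  χᶜ≤1 s τ = m∸n≤m 1 (χ s τ)

  χ-mono : ∀ {s s′} σ ρ → s ≤ s′ → χ s σ ≤ χ s′ (σ ++ ρ)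
  χ-mono {s} {s′} σ ρ s≤s′ with χ s σ | χ-view s σ | χ s′ (σ ++ ρ) | χ-view s′ (σ ++ ρ)
  ... | _ | outside _ | _ | _ = z≤n
  ... | _ | inside _ | _ | inside _ = ≤-refl
  ... | _ | inside h | _ | outside ¬h = contradiction (Hits-mono σ ρ s≤s′ h) ¬h

  χ-mono-stage : ∀ {s s′} τ → s ≤ s′ → χ s τ ≤ χ s′ τ
  χ-mono-stage {s} {s′} τ s≤s′ = subst (λ ρ → χ s τ ≤ χ s′ ρ) (++-identityʳ τ) (χ-mono τ [] s≤s′)

  -- Bounds the lengths of the strings enumerated before stage s, since length σ ≤ code σ.
  resolution : ℕ → ℕ
  resolution = sumTo e

  -- A string enumerated before stage `s` is no longer than its code, hence no longer than
  -- `resolution s`, so the bits of `ρ` cannot take part in a hit.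
  χ-local : ∀ s σ ρ → resolution s ≤ length σ → χ s (σ ++ ρ) ≡ χ s σ
  χ-local s σ ρ long with χ s σ | χ-view s σ | χ s (σ ++ ρ) | χ-view s (σ ++ ρ)
  ... | _ | inside _ | _ | inside _ = refl
  ... | _ | outside _ | _ | outside _ = refl
  ... | _ | inside h | _ | outside ¬h = contradiction (Hits-mono σ ρ ≤-refl h) ¬h
  ... | _ | outside ¬h | _ | inside (i , j , i<s , j≤ , eq) =
    contradiction (i , j , i<s , j≤σ , trans eq (cong (suc ∘ code) (take-++-≤ j σ ρ j≤σ))) ¬h
    where
    open ≤-Reasoning
    j≤σ : j ≤ length σ
    j≤σ = begin
      j                              ≡⟨ sym (m≤n⇒m⊓n≡m j≤) ⟩
      j ⊓ length (σ ++ ρ)            ≡⟨ sym (length-take j (σ ++ ρ)) ⟩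
      length (take j (σ ++ ρ))       ≤⟨ length≤code (take j (σ ++ ρ)) ⟩
      code (take j (σ ++ ρ))         ≤⟨ n≤1+n _ ⟩
      suc (code (take j (σ ++ ρ)))   ≡⟨ sym eq ⟩
      e i                            ≤⟨ f≤sumTo e i i<s ⟩
      resolution s                   ≤⟨ long ⟩
      length σ                       ∎

  -- The second summand counts what stage `s′` adds to stage `s`, so the two are never 1 together.
  χ-gain : ∀ s s′ τ → χ s τ + χ s′ τ * χᶜ s τ ≤ χ (s ⊔ s′) τ
  χ-gain s s′ τ with χ s τ | χ-view s τ | χ-mono-stage {s} {s ⊔ s′} τ (m≤m⊔n s s′)
  ... | _ | inside _ | le = ≤-trans (≤-reflexive (cong suc (*-zeroʳ (χ s′ τ)))) le
  ... | _ | outside _ | _ =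
    ≤-trans (≤-reflexive (*-identityʳ _)) (χ-mono-stage {s′} {s ⊔ s′} τ (m≤n⊔m s s′))

  module _ (em : ExcludedMiddle 0ℓ) (K : ℕ) where

    -- Beyond stage `s₀` the open set gains measure at most 1/`K`: the clopen approximation up to ε.
    -- Short strings are exempt, since stage `s₀` may miss a string and still hit some of its
    -- extensions.
    Saturated : ℕ → ℕ → Set
    Saturated s₀ L₀ = ∀ s L → L₀ ≤ L → ∫ L (λ τ → χ s τ * χᶜ s₀ τ) * K ≤ 2 ^ L

    unsaturated : ∀ s₀ L₀ → ¬ Saturated s₀ L₀ →
      ∃₂ λ s L → L₀ ≤ L × 2 ^ L ≤ ∫ L (λ τ → χ s τ * χᶜ s₀ τ) * K
    unsaturated s₀ L₀ ¬sat with em {∃₂ λ s L → L₀ ≤ L × 2 ^ L ≤ ∫ L (λ τ → χ s τ * χᶜ s₀ τ) * K}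
    ... | yes found = found
    ... | no ¬found = contradiction
      (λ s L L₀≤L → ≮⇒≥ λ 2^L< → ¬found (s , L , L₀≤L , <⇒≤ 2^L<)) ¬sat

    -- Each failure of saturation adds measure 1 / K to the enumerated set, so there are at most K.
    climb : ¬ ∃₂ Saturated → ∀ j → ∃₂ λ s L₀ → ∀ L → L₀ ≤ L → j * 2 ^ L ≤ ∫ L (χ s) * K
    climb ¬sat zero = 0 , 0 , λ _ _ → z≤n
    climb ¬sat (suc j)
      with s , L₀ , big ← climb ¬sat j
      with s′ , L , L₀≤L , gain ← unsaturated s L₀ (λ sat → ¬sat (s , L₀ , sat)) =
      -- The gain is known at the single resolution `L`; persistence of hits under extension carries
      -- it to every larger `M`.
      s ⊔ s′ , L , λ M L≤M → subst (λ M → suc j * 2 ^ M ≤ ∫ M (χ (s ⊔ s′)) * K) (m+[n∸m]≡n L≤M)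
        (begin
          suc j * 2 ^ (L + (M ∸ L))        ≡⟨ cong (suc j *_) (^-distribˡ-+-* 2 L (M ∸ L)) ⟩
          suc j * (2 ^ L * 2 ^ (M ∸ L))    ≡⟨ sym (*-assoc (suc j) (2 ^ L) _) ⟩
          suc j * 2 ^ L * 2 ^ (M ∸ L)      ≤⟨ *-monoˡ-≤ (2 ^ (M ∸ L)) at-L ⟩
          ∫ L (χ (s ⊔ s′)) * K * 2 ^ (M ∸ L) ≡⟨ swap (∫ L (χ (s ⊔ s′))) K _ ⟩
          ∫ L (χ (s ⊔ s′)) * 2 ^ (M ∸ L) * K
            ≤⟨ *-monoˡ-≤ K (∫-extend L (M ∸ L) (χ (s ⊔ s′)) λ σ ρ → χ-mono {s ⊔ s′} σ ρ ≤-refl) ⟩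
          ∫ (L + (M ∸ L)) (χ (s ⊔ s′)) * K ∎)
      where
      open ≤-Reasoning
      swap : ∀ a b c → a * b * c ≡ a * c * b
      swap = solve-∀
      at-L : suc j * 2 ^ L ≤ ∫ L (χ (s ⊔ s′)) * K
      at-L = begin
        2 ^ L + j * 2 ^ L ≤⟨ +-mono-≤ gain (big L L₀≤L) ⟩
        ∫ L (λ τ → χ s′ τ * χᶜ s τ) * K + ∫ L (χ s) * K
          ≡⟨ sym (*-distribʳ-+ K (∫ L (λ τ → χ s′ τ * χᶜ s τ)) _) ⟩
        (∫ L (λ τ → χ s′ τ * χᶜ s τ) + ∫ L (χ s)) * K ≡⟨ cong (_* K) (+-comm _ (∫ L (χ s))) ⟩
        (∫ L (χ s) + ∫ L (λ τ → χ s′ τ * χᶜ s τ)) * K ≡⟨ cong (_* K) (sym (∫-+ L (χ s) _)) ⟩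
        ∫ L (λ τ → χ s τ + χ s′ τ * χᶜ s τ) * K ≤⟨ *-monoˡ-≤ K (∫-mono L λ τ _ → χ-gain s s′ τ) ⟩
        ∫ L (χ (s ⊔ s′)) * K ∎

    saturation : ∃₂ Saturated
    saturation with em {∃₂ Saturated}
    ... | yes sat = sat
    ... | no ¬sat with s , L , big ← climb ¬sat (suc K) = contradiction (big L ≤-refl) (<⇒≱ small)
      where
      open ≤-Reasoning
      small : ∫ L (χ s) * K < suc K * 2 ^ L
      small = begin-strict
        ∫ L (χ s) * K ≤⟨ *-monoˡ-≤ K (∫≤2^ L (χ s) (χ≤1 s)) ⟩
        2 ^ L * K     ≡⟨ *-comm (2 ^ L) K ⟩
        K * 2 ^ L     <⟨ +-monoˡ-< (K * 2 ^ L) (m^n>0 2 L) ⟩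
        suc K * 2 ^ L ∎

-- Avoiding the open set along an arithmetic progression of shifts

module Avoidance (e : ℕ → ℕ) (r : ℕ)
  (positive : ∀ s L → approx e s L * 2 ^ r ≤ (2 ^ r ∸ 1) * 2 ^ L) where
  open Enumeration e

  χᶜ-lower : ∀ s L → 2 ^ L ≤ ∫ L (χᶜ s) * 2 ^ r
  χᶜ-lower s L = subst (λ R → 2 ^ L ≤ ∫ L (χᶜ s) * R) 2^r≡
    (complement-lower {∫ L (χ s)} {∫ L (χᶜ s)} (pred (2 ^ r)) (trans (+-comm (∫ L (χ s)) _) (∫-complement L (χ s) (χ≤1 s)))
      (subst₂ (λ c R → c * R ≤ pred (2 ^ r) * 2 ^ L) (countTrue≡∫ L (hit e s)) (sym 2^r≡)
        (positive s L)))
    where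
    2^r≡ : suc (pred (2 ^ r)) ≡ 2 ^ r
    2^r≡ = suc-pred (2 ^ r) {{m^n≢0 2 r}}

  -- Enumerating the empty string would leave a complement of measure 0.
  ¬Hits[] : ∀ s → ¬ Hits s []
  ¬Hits[] s h with χ s [] | χ-view s [] | χᶜ-lower s 0
  ... | _ | inside _ | ()
  ... | _ | outside ¬h | _ = ¬h h

  -- Tests the shifts by 0, a, ..., (k-1)a. The progression of the theorem starts at a instead, so
  -- the bits before it are dropped first.
  avoid : ℕ → ℕ → ℕ → List Bool → ℕ
  avoid s a zero ρ = 1
  avoid s a (suc k) ρ = χᶜ s ρ * avoid s a k (drop a ρ)

  avoid≤1 : ∀ s a k ρ → avoid s a k ρ ≤ 1
  avoid≤1 s a zero ρ = ≤-refl
  avoid≤1 s a (suc k) ρ = *-mono-≤ (χᶜ≤1 s ρ) (avoid≤1 s a k (drop a ρ))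

  avoid-antitone : ∀ s a k σ ρ → avoid s a k (σ ++ ρ) ≤ avoid s a k σ
  avoid-antitone s a zero σ ρ = ≤-refl
  avoid-antitone s a (suc k) σ ρ rewrite drop-++ a σ ρ =
    *-mono-≤ (∸-monoʳ-≤ 1 (χ-mono {s} σ ρ ≤-refl)) (avoid-antitone s a k (drop a σ) _)

  Hits⇒avoid≡0 : ∀ s a k ρ i → i < k → Hits s (drop (i * a) ρ) → avoid s a k ρ ≡ 0
  Hits⇒avoid≡0 s a (suc k) ρ zero _ h with χ s ρ | χ-view s ρ
  ... | _ | inside _ = refl
  ... | _ | outside ¬h = contradiction h ¬h
  Hits⇒avoid≡0 s a (suc k) ρ (suc i) (s≤s i<k) h
    rewrite Hits⇒avoid≡0 s a k (drop a ρ) i i<k (subst (Hits s) (sym (drop-drop a (i * a) ρ)) h) =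
    *-zeroʳ (χᶜ s ρ)

  -- Since `a` is at least `resolution s`, each factor reads only its own block of `a` bits; the
  -- factors are independent, each of measure at least 2^-r.
  avoid-lower : ∀ s {a} → resolution s ≤ a → ∀ k L →
    2 ^ (k * a + L) ≤ ∫ (k * a + L) (avoid s a k) * (2 ^ r) ^ k
  avoid-lower s {a} fine zero L = ≤-reflexive (sym (trans (*-identityʳ _) (∫-1 L)))
  avoid-lower s {a} fine (suc k) L = begin
    2 ^ (a + k * a + L)         ≡⟨ cong (2 ^_) (+-assoc a (k * a) L) ⟩
    2 ^ (a + (k * a + L))       ≡⟨ ^-distribˡ-+-* 2 a (k * a + L) ⟩
    2 ^ a * 2 ^ (k * a + L)     ≤⟨ *-mono-≤ (χᶜ-lower s a) (avoid-lower s fine k L) ⟩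
    ∫ a (χᶜ s) * 2 ^ r * (∫ (k * a + L) (avoid s a k) * (2 ^ r) ^ k)
      ≡⟨ regroup (∫ a (χᶜ s)) (2 ^ r) _ ((2 ^ r) ^ k) ⟩
    ∫ a (χᶜ s) * ∫ (k * a + L) (avoid s a k) * (2 ^ r) ^ suc k
      ≡⟨ cong (_* (2 ^ r) ^ suc k) (sym (∫-independent a (k * a + L) (χᶜ s) (avoid s a k)
           λ { σ ρ refl → cong (1 ∸_) (χ-local s σ ρ fine) })) ⟩
    ∫ (a + (k * a + L)) (avoid s a (suc k)) * (2 ^ r) ^ suc k
      ≡⟨ cong (λ M → ∫ M (avoid s a (suc k)) * (2 ^ r) ^ suc k) (sym (+-assoc a (k * a) L)) ⟩
    ∫ (a + k * a + L) (avoid s a (suc k)) * (2 ^ r) ^ suc k ∎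
    where
    open ≤-Reasoning
    regroup : ∀ u R v S → u * R * (v * S) ≡ u * v * (R * S)
    regroup = solve-∀

  -- The number of tested shifts that stage `s` hits and stage `s₀` does not. Being a count, it
  -- turns the union bound into additivity of the integral.
  escape : ℕ → ℕ → ℕ → ℕ → List Bool → ℕ
  escape s₀ s a zero ρ = 0
  escape s₀ s a (suc k) ρ = χ s ρ * χᶜ s₀ ρ + escape s₀ s a k (drop a ρ)

  escape-upper : ∀ {K s₀ L₀} s a → (∀ L → L₀ ≤ L → ∫ L (λ τ → χ s τ * χᶜ s₀ τ) * K ≤ 2 ^ L) →
    ∀ k L → L₀ ≤ L → ∫ (k * a + L) (escape s₀ s a k) * K ≤ k * 2 ^ (k * a + L)
  escape-upper {K} s a sat zero L L₀≤L =
    ≤-reflexive (cong (_* K) (∫-const L 0))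
  escape-upper {K} {s₀} s a sat (suc k) L L₀≤L rewrite +-assoc a (k * a) L = begin
    ∫ (a + M) (λ ρ → χ s ρ * χᶜ s₀ ρ + escape s₀ s a k (drop a ρ)) * K
      ≡⟨ cong (_* K) (trans (∫-+ (a + M) _ (escape s₀ s a k ∘ drop a))
           (cong (∫ (a + M) (λ ρ → χ s ρ * χᶜ s₀ ρ) +_) (∫-drop a M (escape s₀ s a k)))) ⟩
    (∫ (a + M) (λ ρ → χ s ρ * χᶜ s₀ ρ) + 2 ^ a * ∫ M (escape s₀ s a k)) * K
      ≡⟨ regroup (∫ (a + M) (λ ρ → χ s ρ * χᶜ s₀ ρ)) (2 ^ a) _ K ⟩
    ∫ (a + M) (λ ρ → χ s ρ * χᶜ s₀ ρ) * K + 2 ^ a * (∫ M (escape s₀ s a k) * K)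
      ≤⟨ +-mono-≤ (sat (a + M) (≤-trans L₀≤L (≤-trans (m≤n+m L (k * a)) (m≤n+m M a))))
           (*-monoʳ-≤ (2 ^ a) (escape-upper {K} s a sat k L L₀≤L)) ⟩
    2 ^ (a + M) + 2 ^ a * (k * 2 ^ M)
      ≡⟨ cong (2 ^ (a + M) +_) (trans (swap (2 ^ a) k _) (cong (k *_) (sym (^-distribˡ-+-* 2 a M)))) ⟩
    suc k * 2 ^ (a + M) ∎
    where
    open ≤-Reasoning
    M : ℕ
    M = k * a + L
    regroup : ∀ u p v K → (u + p * v) * K ≡ u * K + p * (v * K)
    regroup = solve-∀
    swap : ∀ p k q → p * (k * q) ≡ k * (p * q)
    swap = solve-∀

  χᶜ-split : ∀ s₀ s ρ → χᶜ s₀ ρ ≤ χᶜ s ρ + χ s ρ * χᶜ s₀ ρ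
  χᶜ-split s₀ s ρ with hit e s ρ
  ... | true = ≤-reflexive (sym (*-identityˡ _))
  ... | false = χᶜ≤1 s₀ ρ

  -- A shift that avoids stage `s₀` avoids stage `s` too or is counted by `escape`; apply this to
  -- one factor after the other, all of them being at most 1.
  avoid-split : ∀ s₀ s a k ρ → avoid s₀ a k ρ ≤ avoid s a k ρ + escape s₀ s a k ρ
  avoid-split s₀ s a zero ρ = ≤-refl
  avoid-split s₀ s a (suc k) ρ = begin
    χᶜ s₀ ρ * A₀               ≤⟨ *-monoˡ-≤ A₀ (χᶜ-split s₀ s ρ) ⟩
    (χᶜ s ρ + E) * A₀          ≡⟨ *-distribʳ-+ A₀ (χᶜ s ρ) E ⟩
    χᶜ s ρ * A₀ + E * A₀       ≤⟨ +-mono-≤ (*-monoʳ-≤ (χᶜ s ρ) (avoid-split s₀ s a k (drop a ρ)))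
                                   (*-monoʳ-≤ E (avoid≤1 s₀ a k (drop a ρ))) ⟩
    χᶜ s ρ * (A + E′) + E * 1  ≡⟨ regroup (χᶜ s ρ) A E′ E ⟩
    χᶜ s ρ * A + (E + χᶜ s ρ * E′)
      ≤⟨ +-monoʳ-≤ (χᶜ s ρ * A) (+-monoʳ-≤ E (*-monoˡ-≤ E′ (χᶜ≤1 s ρ))) ⟩
    χᶜ s ρ * A + (E + 1 * E′)  ≡⟨ cong (λ x → χᶜ s ρ * A + (E + x)) (*-identityˡ E′) ⟩
    χᶜ s ρ * A + (E + E′)      ∎
    where
    open ≤-Reasoning
    A₀ A E E′ : ℕ
    A₀ = avoid s₀ a k (drop a ρ)
    A = avoid s a k (drop a ρ)
    E = χ s ρ * χᶜ s₀ ρ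
    E′ = escape s₀ s a k (drop a ρ)
    regroup : ∀ c A E′ E → c * (A + E′) + E * 1 ≡ c * A + (E + c * E′)
    regroup = solve-∀

  -- Half of the measure that the k independent blocks give at stage s₀ survives at every later stage.
  avoid-uniform-lower : ∀ k .{{_ : NonZero k}} {s₀ L₀ a} s → let N = 2 * (2 ^ r) ^ k in
    (∀ L → L₀ ≤ L → ∫ L (λ τ → χ s τ * χᶜ s₀ τ) * (k * N) ≤ 2 ^ L) → resolution s₀ ≤ a →
    ∀ L → L₀ ≤ L → 2 ^ (k * a + L) ≤ ∫ (k * a + L) (avoid s a k) * N
  avoid-uniform-lower k {s₀} {L₀} {a} s sat fine L L₀≤L = +-cancelʳ-≤ (2 ^ M) _ _ (begin
    -- In terms of measure: stage `s₀` is avoided with at least 1/R = 2/N, and the escaping shifts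
    -- take away at most k/(kN) = 1/N.
    2 ^ M + 2 ^ M                            ≤⟨ +-mono-≤ lower lower ⟩
    ∫ M (avoid s₀ a k) * R + ∫ M (avoid s₀ a k) * R ≡⟨ double (∫ M (avoid s₀ a k)) R ⟩
    ∫ M (avoid s₀ a k) * N                   ≤⟨ *-monoˡ-≤ N (∫-mono M λ τ _ → avoid-split s₀ s a k τ) ⟩
    ∫ M (λ τ → avoid s a k τ + escape s₀ s a k τ) * N
      ≡⟨ cong (_* N) (∫-+ M (avoid s a k) _) ⟩
    (∫ M (avoid s a k) + ∫ M (escape s₀ s a k)) * N ≡⟨ *-distribʳ-+ N (∫ M (avoid s a k)) _ ⟩
    ∫ M (avoid s a k) * N + ∫ M (escape s₀ s a k) * N
      ≤⟨ +-monoʳ-≤ (∫ M (avoid s a k) * N) (*-cancelˡ-≤ k upper) ⟩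
    ∫ M (avoid s a k) * N + 2 ^ M ∎)
    where
    open ≤-Reasoning
    M R N : ℕ
    M = k * a + L
    R = (2 ^ r) ^ k
    N = 2 * R
    lower : 2 ^ M ≤ ∫ M (avoid s₀ a k) * R
    lower = avoid-lower s₀ fine k L
    double : ∀ x R → x * R + x * R ≡ x * (2 * R)
    double = solve-∀
    swap : ∀ k x N → k * (x * N) ≡ x * (k * N)
    swap = solve-∀
    upper : k * (∫ M (escape s₀ s a k) * N) ≤ k * 2 ^ M
    upper = ≤-trans (≤-reflexive (swap k (∫ M (escape s₀ s a k)) N))
      (escape-upper {k * N} s a sat k L L₀≤L)

  meets : ℕ → ℕ → ℕ → ℕ → List Bool → ℕ
  meets s a k d ρ = 1 ∸ avoid s a k (drop d ρ)

  -- The bound does not depend on the stage, the anchor or the offset `d`. This matters because all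
  -- three vary as the process runs.
  meets-upper : ∀ k .{{_ : NonZero k}} {s₀ L₀ a} s → let N = 2 * (2 ^ r) ^ k in
    (∀ L → L₀ ≤ L → ∫ L (λ τ → χ s τ * χᶜ s₀ τ) * (k * N) ≤ 2 ^ L) → resolution s₀ ≤ a →
    ∀ d L → ∫ L (meets s a k d) * N ≤ pred N * 2 ^ L
  meets-upper k {s₀} {L₀} {a} s sat fine d L = *-cancelʳ-≤ _ _ (2 ^ M) {{m^n≢0 2 M}} (begin
    ∫ L (meets s a k d) * N * 2 ^ M ≡⟨ swap (∫ L (meets s a k d)) N (2 ^ M) ⟩
    ∫ L (meets s a k d) * 2 ^ M * N ≤⟨ *-monoˡ-≤ N (∫-extend L M (meets s a k d) meets-mono) ⟩
    ∫ (L + M) (meets s a k d) * N ≤⟨ subst₂ (λ W N → ∫ W (meets s a k d) * N ≤ pred N * 2 ^ W) L+M N≡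
        (complement-upper {∫ (d + U) (meets s a k d)} {∫ (d + U) (avoid s a k ∘ drop d)} (pred N)
          (∫-complement (d + U) _ (λ ρ → avoid≤1 s a k (drop d ρ))) large) ⟩
    pred N * 2 ^ (L + M) ≡⟨ cong (pred N *_) (^-distribˡ-+-* 2 L M) ⟩
    pred N * (2 ^ L * 2 ^ M) ≡⟨ sym (*-assoc (pred N) (2 ^ L) (2 ^ M)) ⟩
    pred N * 2 ^ L * 2 ^ M ∎)
    where
    open ≤-Reasoning
    M N U : ℕ
    -- `L` may be too small for the lower bound, so `M` more bits are read and the factor 2^`M` is
    -- cancelled in the end.
    M = d + (k * a + L₀)
    N = 2 * (2 ^ r) ^ k
    U = k * a + (L₀ + L)
    N≡ : suc (pred N) ≡ N
    N≡ = suc-pred N {{m*n≢0 2 _ {{_}} {{m^n≢0 (2 ^ r) k {{m^n≢0 2 r}}}}}}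
    L+M : d + (k * a + (L₀ + L)) ≡ L + M
    L+M = rearrange d (k * a) L₀ L
      where
      rearrange : ∀ d ka L₀ L → d + (ka + (L₀ + L)) ≡ L + (d + (ka + L₀))
      rearrange = solve-∀
    swap : ∀ a b c → a * b * c ≡ a * c * b
    swap = solve-∀
    meets-mono : ∀ σ ρ → meets s a k d σ ≤ meets s a k d (σ ++ ρ)
    meets-mono σ ρ rewrite drop-++ d σ ρ = ∸-monoʳ-≤ 1 (avoid-antitone s a k (drop d σ) _)
    large : 2 ^ (d + U) ≤ ∫ (d + U) (avoid s a k ∘ drop d) * suc (pred N)
    large = subst (λ N → 2 ^ (d + U) ≤ ∫ (d + U) (avoid s a k ∘ drop d) * N) (sym N≡) (begin
      2 ^ (d + U)         ≡⟨ ^-distribˡ-+-* 2 d U ⟩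
      2 ^ d * 2 ^ U       ≤⟨ *-monoʳ-≤ (2 ^ d) (avoid-uniform-lower k {s₀} s sat fine (L₀ + L) (m≤m+n L₀ L)) ⟩
      2 ^ d * (∫ U (avoid s a k) * N) ≡⟨ sym (*-assoc (2 ^ d) _ N) ⟩
      2 ^ d * ∫ U (avoid s a k) * N ≡⟨ cong (_* N) (sym (∫-drop d U (avoid s a k))) ⟩
      ∫ (d + U) (avoid s a k ∘ drop d) * N ∎)

-- The decay of (x / (1 + x))ⁿ

-- Bernoulli's inequality 1 + n/x ≤ (1 + 1/x)^n, multiplied by x^(n+1).
bernoulli : ∀ x n → (x + n) * x ^ n ≤ x * suc x ^ n
bernoulli x zero = ≤-reflexive (cong (_* 1) (+-identityʳ x))
bernoulli x (suc n) = begin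
  (x + suc n) * (x * x ^ n)                ≤⟨ m≤m+n _ (n * x ^ n) ⟩
  (x + suc n) * (x * x ^ n) + n * x ^ n    ≡⟨ expand x n (x ^ n) ⟩
  suc x * ((x + n) * x ^ n)                ≤⟨ *-monoʳ-≤ (suc x) (bernoulli x n) ⟩
  suc x * (x * suc x ^ n)                  ≡⟨ swap (suc x) x _ ⟩
  x * (suc x * suc x ^ n)                  ∎
  where
  open ≤-Reasoning
  expand : ∀ x n p → (x + suc n) * (x * p) + n * p ≡ suc x * ((x + n) * p)
  expand = solve-∀
  swap : ∀ a b c → a * (b * c) ≡ b * (a * c)
  swap = solve-∀

-- Bernoulli with exponent 1 + x. With N = 1 + x, it says that N replacements at least halve the
-- measure.
2x^[1+x]≤[1+x]^[1+x] : ∀ x .{{_ : NonZero x}} → 2 * x ^ suc x ≤ suc x ^ suc x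
2x^[1+x]≤[1+x]^[1+x] x = *-cancelˡ-≤ x (begin
  x * (2 * x ^ suc x)       ≡⟨ expand x (x ^ suc x) ⟩
  (x + x) * x ^ suc x       ≤⟨ *-monoˡ-≤ (x ^ suc x) (+-monoʳ-≤ x (n≤1+n x)) ⟩
  (x + suc x) * x ^ suc x   ≤⟨ bernoulli x (suc x) ⟩
  x * suc x ^ suc x         ∎)
  where
  open ≤-Reasoning
  expand : ∀ x p → x * (2 * p) ≡ (x + x) * p
  expand = solve-∀

^-mono-* : ∀ a b c m → a * b ≤ c → a ^ m * b ^ m ≤ c ^ m
^-mono-* a b c zero le = ≤-refl
^-mono-* a b c (suc m) le = ≤-trans (≤-reflexive (regroup a (a ^ m) b (b ^ m)))
  (*-mono-≤ le (^-mono-* a b c m le))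
  where
  regroup : ∀ a p b q → a * p * (b * q) ≡ a * b * (p * q)
  regroup = solve-∀

geometric-decay : ∀ x .{{_ : NonZero x}} m c t →
  c * suc x ^ (suc x * m) ≤ x ^ (suc x * m) * t → c * 2 ^ m ≤ t
geometric-decay x m c t le = *-cancelˡ-≤ (x ^ (suc x * m)) {{m^n≢0 x (suc x * m)}} (begin
  x ^ (suc x * m) * (c * 2 ^ m)     ≡⟨ cong (_* (c * 2 ^ m)) (sym (^-*-assoc x (suc x) m)) ⟩
  (x ^ suc x) ^ m * (c * 2 ^ m)     ≡⟨ regroup ((x ^ suc x) ^ m) c (2 ^ m) ⟩
  c * (2 ^ m * (x ^ suc x) ^ m)
    ≤⟨ *-monoʳ-≤ c (^-mono-* 2 (x ^ suc x) _ m (2x^[1+x]≤[1+x]^[1+x] x)) ⟩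
  c * (suc x ^ suc x) ^ m           ≡⟨ cong (c *_) (^-*-assoc (suc x) (suc x) m) ⟩
  c * suc x ^ (suc x * m)           ≤⟨ le ⟩
  x ^ (suc x * m) * t               ∎)
  where
  open ≤-Reasoning
  regroup : ∀ p c q → p * (c * q) ≡ c * (q * p)
  regroup = solve-∀

-- Prefixes, slices and threshold indicators

length-∷ʳ : ∀ (h : List Bool) b → length (h ∷ʳ b) ≡ suc (length h)
length-∷ʳ [] b = refl
length-∷ʳ (_ ∷ h) b = cong suc (length-∷ʳ h b)

take-snoc : ∀ (h : List Bool) b ρ → take (suc (length h)) (h ++ b ∷ ρ) ≡ h ∷ʳ b
take-snoc [] b ρ = refl
take-snoc (c ∷ h) b ρ = cong (c ∷_) (take-snoc h b ρ)

length-prefix : ∀ L Y → length (prefix L Y) ≡ L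
length-prefix zero Y = refl
length-prefix (suc L) Y = cong suc (length-prefix L _)

take-prefix : ∀ n {L} Y → n ≤ L → take n (prefix L Y) ≡ prefix n Y
take-prefix zero Y _ = refl
take-prefix (suc n) Y (s≤s n≤L) = cong (Y 0 ∷_) (take-prefix n _ n≤L)

slice-prefix : ∀ p n {L} Y → p + n ≤ L → take n (drop p (prefix L Y)) ≡ prefix n (shift p Y)
slice-prefix zero n Y le = take-prefix n Y le
slice-prefix (suc p) n Y (s≤s le) = slice-prefix p n _ le

cond-positive : ∀ {A : Set} {c} {t f : A} → 0 < c → cond c t f ≡ t
cond-positive (s≤s _) = refl

cond-zero : ∀ {A : Set} {c} {t f : A} → c ≡ 0 → cond c t f ≡ f
cond-zero refl = refl

-- Defined by recursion so that one replacement, a `suc` in `run`, lowers the threshold by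
-- computation.
atLeast : ℕ → ℕ → ℕ
atLeast zero _ = 1
atLeast (suc J) zero = 0
atLeast (suc J) (suc n) = atLeast J n

≤⇒atLeast : ∀ {J n} → J ≤ n → atLeast J n ≡ 1
≤⇒atLeast z≤n = refl
≤⇒atLeast (s≤s le) = ≤⇒atLeast le

-- The anchor process and the test built from it

module Process (e : ℕ → ℕ) (k n₀ : ℕ) where
  open Enumeration e

  -- Positive iff the string σ of code y and length ℓ shows, within ℓ stages, that some shift of
  -- σ by a positive multiple ≤ k a of a enters the enumerated open set.
  witness : ℕ → ℕ → ℕ → ℕ
  witness a y ℓ =
    sumTo (λ i → sumTo (λ s → sumTo (λ j →
      eq# (e s) (suc (take# j (drop# (suc i * a) y)))) (suc ℓ)) ℓ) k

  witnessed : ℕ → List Bool → ℕ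
  witnessed a σ = witness a (code σ) (length σ)

  -- `anchor` and `count` work on the code of a whole string, which makes them primitive recursive;
  -- `run` is the form suited to induction and integration.
  anchor : ℕ → ℕ → ℕ
  anchor zero x = n₀
  anchor (suc ℓ) x = cond (witness (anchor ℓ x) (take# (suc ℓ) x) (suc ℓ)) (suc ℓ) (anchor ℓ x)

  count : ℕ → ℕ → ℕ
  count zero x = 0
  count (suc ℓ) x = cond (witness (anchor ℓ x) (take# (suc ℓ) x) (suc ℓ)) 1 0 + count ℓ x

  -- Stage `x` enumerates the string with code `x` itself if its count reaches `N * m`; otherwise
  -- the value 0 enumerates nothing.
  test : ℕ → ℕ → ℕ → ℕ
  test N m x = cond (suc (count (length# x) x) ∸ N * m) (suc x) 0

  -- The same process, reading ρ bit by bit after the history h.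
  run : List Bool → ℕ → List Bool → ℕ
  run h a [] = 0
  run h a (b ∷ ρ) = cond (witnessed a (h ∷ʳ b))
    (suc (run (h ∷ʳ b) (length (h ∷ʳ b)) ρ)) (run (h ∷ʳ b) a ρ)

  count-run : ∀ h ρ → let x = code (h ++ ρ) in
    count (length (h ++ ρ)) x ≡ run h (anchor (length h) x) ρ + count (length h) x
  count-run h [] rewrite ++-identityʳ h = refl
  count-run h (b ∷ ρ)
    with ih ← count-run (h ∷ʳ b) ρ
    rewrite ∷ʳ-++ h b ρ | length-∷ʳ h b
          | take#-code (suc (length h)) (h ++ b ∷ ρ) | take-snoc h b ρ
    with witness (anchor (length h) (code (h ++ b ∷ ρ))) (code (h ∷ʳ b)) (suc (length h))
  ... | zero = ih
  ... | suc _ = trans ih (+-suc _ _)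

  count≡run : ∀ σ → count (length# (code σ)) (code σ) ≡ run [] n₀ σ
  count≡run σ = trans (cong (λ ℓ → count ℓ (code σ)) (length#-code σ))
    (trans (count-run [] σ) (+-identityʳ _))

  run-mono : ∀ h a σ ρ → run h a σ ≤ run h a (σ ++ ρ)
  run-mono h a [] ρ = z≤n
  run-mono h a (b ∷ σ) ρ with witnessed a (h ∷ʳ b)
  ... | zero = run-mono _ _ σ ρ
  ... | suc _ = s≤s (run-mono _ _ σ ρ)

  Visits : ℕ → List Bool → Set
  Visits a σ = ∃ λ i → i < k × Hits (length σ) (drop (suc i * a) σ)

  Visits-++ : ∀ a σ ρ → Visits a σ → Visits a (σ ++ ρ)
  Visits-++ a σ ρ (i , i<k , hits) = i , i<k ,
    subst (Hits (length (σ ++ ρ))) (sym (drop-++ (suc i * a) σ ρ))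
      (Hits-mono (drop (suc i * a) σ) (drop (suc i * a ∸ length σ) ρ) longer hits)
    where
    longer : length σ ≤ length (σ ++ ρ)
    longer = ≤-trans (m≤m+n _ _) (≤-reflexive (sym (length-++ σ)))

  witnessed⇒Visits : ∀ a σ → 0 < witnessed a σ →
    Visits a σ
  witnessed⇒Visits a σ pos
    with i , i<k , posᵢ ← sumTo>0⁻¹ _ k pos
    with s , s<ℓ , posₛ ← sumTo>0⁻¹ _ (length σ) posᵢ
    with j , _ , posⱼ ← sumTo>0⁻¹ _ (suc (length σ)) posₛ =
    -- `witness` lets j run past the end of `τ`, where `take` returns all of `τ`; `Hits` needs a
    -- position inside it.
    i , i<k , s , j ⊓ length τ , s<ℓ , m⊓n≤n j (length τ) , (begin
      e s                                      ≡⟨ eq#⇒≡ {e s} {suc (take# j (drop# (suc i * a) (code σ)))} posⱼ ⟩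
      suc (take# j (drop# (suc i * a) (code σ))) ≡⟨ cong (suc ∘ take# j) (drop#-code (suc i * a) σ) ⟩
      suc (take# j (code τ))                   ≡⟨ cong suc (take#-code j τ) ⟩
      suc (code (take j τ))                    ≡⟨ cong (suc ∘ code ∘ take j) (sym (take-all (length τ) τ ≤-refl)) ⟩
      suc (code (take j (take (length τ) τ)))  ≡⟨ cong (suc ∘ code) (take-take j (length τ) τ) ⟩
      suc (code (take (j ⊓ length τ) τ))       ∎)
    where
    open ≡-Reasoning
    τ : List Bool
    τ = drop (suc i * a) σ

  witnessed-intro : ∀ a σ {i s j} → i < k → s < length σ → j ≤ length σ →
    e s ≡ suc (code (take j (drop (suc i * a) σ))) → 0 < witnessed a σ
  witnessed-intro a σ {i} {s} {j} i<k s<ℓ j≤ℓ eq =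
    sumTo>0 _ i i<k (sumTo>0 _ s s<ℓ (sumTo>0 _ j (s≤s j≤ℓ) (eq#-refl {e s}
      (trans eq (cong suc (trans (sym (take#-code j _)) (cong (take# j) (sym (drop#-code (suc i * a) σ)))))))))

  -- Until the first replacement the anchor is still `a`, so that replacement shows a visit for `a`,
  -- and visits persist under extension.
  run>0⇒Visits : ∀ h a ρ → 0 < run h a ρ → Visits a (h ++ ρ)
  run>0⇒Visits h a (b ∷ ρ) pos with witnessed a (h ∷ʳ b) in eq
  ... | zero = subst (Visits a) (∷ʳ-++ h b ρ) (run>0⇒Visits (h ∷ʳ b) a ρ pos)
  ... | suc _ = subst (Visits a) (∷ʳ-++ h b ρ) (Visits-++ a (h ∷ʳ b) ρ
    (witnessed⇒Visits a (h ∷ʳ b) (subst (0 <_) (sym eq) (s≤s z≤n))))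

  witness-primRec : PrimRec₁ e → PrimRec₃ witness
  witness-primRec pe = ternary $
    sumTo-primRec (sumTo-primRec (sumTo-primRec
      (app₂ eq#-primRec (app₁ pe (var 1F))
        (app₁ suc-primRec (app₂ take#-primRec (var 0F)
          (app₂ drop#-primRec (app₂ *-primRec (app₁ suc-primRec (var 2F)) (var 3F)) (var 4F)))))
      (app₁ suc-primRec (var 4F))) (var 3F)) (const-primRec k)

  anchor-primRec : PrimRec₁ e → PrimRec₂ anchor
  anchor-primRec pe = binary $ primRec-resp (λ xs → eq (lookup xs 0F) (lookup xs 1F))
    (rec-primRec (const-primRec n₀)
      (app₃ cond-primRec
        (app₃ (witness-primRec pe) (var 1F)
          (app₂ take#-primRec (app₁ suc-primRec (var 0F)) (var 3F)) (app₁ suc-primRec (var 0F)))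
        (app₁ suc-primRec (var 0F)) (var 1F))
      (var 0F))
    where
    eq : ∀ ℓ x → rec n₀ (λ ℓ a → cond (witness a (take# (suc ℓ) x) (suc ℓ)) (suc ℓ) a) ℓ ≡ anchor ℓ x
    eq zero x = refl
    eq (suc ℓ) x rewrite eq ℓ x = refl

  count-primRec : PrimRec₁ e → PrimRec₂ count
  count-primRec pe = binary $ primRec-resp (λ xs → eq (lookup xs 0F) (lookup xs 1F))
    (rec-primRec (const-primRec 0)
      (app₂ +-primRec
        (app₃ cond-primRec
          (app₃ (witness-primRec pe) (app₂ (anchor-primRec pe) (var 0F) (var 3F))
            (app₂ take#-primRec (app₁ suc-primRec (var 0F)) (var 3F)) (app₁ suc-primRec (var 0F)))
          (const-primRec 1) (const-primRec 0))
        (var 1F))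
      (var 0F))
    where
    eq : ∀ ℓ x → rec 0 (λ ℓ c → cond (witness (anchor ℓ x) (take# (suc ℓ) x) (suc ℓ)) 1 0 + c) ℓ ≡ count ℓ x
    eq zero x = refl
    eq (suc ℓ) x = cong (cond (witness (anchor ℓ x) (take# (suc ℓ) x) (suc ℓ)) 1 0 +_) (eq ℓ x)

  test-primRec : PrimRec₁ e → ∀ N → PrimRec₂ (test N)
  test-primRec pe N = binary $
    app₃ cond-primRec
      (app₂ ∸-primRec
        (app₁ suc-primRec (app₂ (count-primRec pe) (app₁ length#-primRec (var 1F)) (var 1F)))
        (app₂ *-primRec (const-primRec N) (var 0F)))
      (app₁ suc-primRec (var 1F)) (const-primRec 0)

  test-intro : ∀ N m σ → N * m ≤ run [] n₀ σ → test N m (code σ) ≡ suc (code σ)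
  test-intro N m σ le = cond-positive
    (m<n⇒0<n∸m (s≤s (≤-trans le (≤-reflexive (sym (count≡run σ))))))

  test-elim : ∀ N m x σ → test N m x ≡ suc (code σ) → N * m ≤ run [] n₀ σ
  test-elim N m x σ eq with suc (count (length# x) x) ∸ N * m in pos
  -- The value 0 is no successor, so the count has reached the threshold; `refl` also identifies `x`
  -- with `code σ`.
  test-elim N m x σ refl | suc _ = ≤-trans
    (s≤s⁻¹ (m∸n≢0⇒n<m λ z → contradiction (trans (sym pos) z) λ ()))
    (≤-reflexive (count≡run σ))

  -- Asking for all large L makes this invariant under moving a bit from Y to h.
  Meeting : List Bool → Cantor → Set
  Meeting h Y = ∀ a → 1 ≤ a → ∃ λ L₀ → ∀ L → L₀ ≤ L → 0 < witnessed a (h ++ prefix L Y)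

  Meeting-step : ∀ h Y → Meeting h Y → Meeting (h ∷ʳ Y 0) (Y ∘ suc)
  Meeting-step h Y meet a 1≤a with L₀ , wit ← meet a 1≤a =
    L₀ , λ L L₀≤L → subst (λ σ → 0 < witnessed a σ) (sym (∷ʳ-++ h (Y 0) _)) (wit (suc L) (m≤n⇒m≤1+n L₀≤L))

  -- Outer recursion on the replacements still wanted, inner recursion on a bound for the bits to
  -- read before the current anchor is witnessed.
  run-unbounded : ∀ J h Y a → 1 ≤ a → Meeting h Y → ∃ λ M → J ≤ run h a (prefix M Y)
  run-unbounded zero h Y a _ _ = 0 , z≤n
  run-unbounded (suc J) h Y a 1≤a meet = go _ h Y meet (proj₂ (meet a 1≤a))
    where
    go : ∀ L₀ h Y → Meeting h Y → (∀ L → L₀ ≤ L → 0 < witnessed a (h ++ prefix L Y)) →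
      ∃ λ M → suc J ≤ run h a (prefix M Y)
    go L₀ h Y meet wit with witnessed a (h ∷ʳ Y 0) in eq
    go L₀ h Y meet wit | suc _
      with M , J≤ ← run-unbounded J (h ∷ʳ Y 0) (Y ∘ suc) (length (h ∷ʳ Y 0))
                      (≤-trans (s≤s z≤n) (≤-reflexive (sym (length-∷ʳ h (Y 0)))))
                      (Meeting-step h Y meet) =
      suc M , ≤-trans (s≤s J≤) (≤-reflexive (sym (cond-positive (subst (0 <_) (sym eq) (s≤s z≤n)))))
    go zero h Y meet wit | zero = contradiction (subst (0 <_) eq (wit 1 z≤n)) λ ()
    go (suc L₀) h Y meet wit | zero
      with M , J≤ ← go L₀ (h ∷ʳ Y 0) (Y ∘ suc) (Meeting-step h Y meet)
             (λ L L₀≤L → subst (λ σ → 0 < witnessed a σ) (sym (∷ʳ-++ h (Y 0) _)) (wit (suc L) (s≤s L₀≤L))) =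
      suc M , ≤-trans J≤ (≤-reflexive (sym (cond-zero eq)))

  module _ {r} (positive : ∀ s L → approx e s L * 2 ^ r ≤ (2 ^ r ∸ 1) * 2 ^ L) where
    open Avoidance e r positive

    -- If `σ` were shorter than `a`, every tested shift would leave the empty string, which is never
    -- hit. Hence replacing an anchor never decreases it.
    witnessed⇒anchor≤length : ∀ a σ → 0 < witnessed a σ → a ≤ length σ
    witnessed⇒anchor≤length a σ pos with i , _ , hits ← witnessed⇒Visits a σ pos =
      ≮⇒≥ λ ℓ<a → ¬Hits[] (length σ) (subst (Hits (length σ))
        (drop-all (suc i * a) σ (≤-trans (<⇒≤ ℓ<a) (m≤m+n a (i * a)))) hits)

    -- As `a` lies at or beyond the end of `h`, each tested shift drops all of `h`: the event
    -- depends on the fresh bits `ρ` alone.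
    Visits⇒avoid≡0 : ∀ h a ρ → length h ≤ a → Visits a (h ++ ρ) →
      avoid (length (h ++ ρ)) a k (drop (a ∸ length h) ρ) ≡ 0
    Visits⇒avoid≡0 h a ρ h≤a (i , i<k , hits) =
      Hits⇒avoid≡0 s a k (drop d ρ) i i<k (subst (Hits s) aligned hits)
      where
      open ≡-Reasoning
      s d : ℕ
      s = length (h ++ ρ)
      d = a ∸ length h
      aligned : drop (suc i * a) (h ++ ρ) ≡ drop (i * a) (drop d ρ)
      aligned = begin
        drop (suc i * a) (h ++ ρ) ≡⟨ drop-++ (suc i * a) h ρ ⟩
        drop (suc i * a) h ++ drop (suc i * a ∸ length h) ρ
          ≡⟨ cong (_++ drop (suc i * a ∸ length h) ρ) (drop-all (suc i * a) h (≤-trans h≤a (m≤m+n a (i * a)))) ⟩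
        drop (a + i * a ∸ length h) ρ ≡⟨ cong (λ n → drop n ρ) (+-∸-comm (i * a) h≤a) ⟩
        drop (d + i * a) ρ ≡⟨ sym (drop-drop d (i * a) ρ) ⟩
        drop (i * a) (drop d ρ) ∎

    run≤meets : ∀ h a ρ → length h ≤ a →
      atLeast 1 (run h a ρ) ≤ meets (length (h ++ ρ)) a k (a ∸ length h) ρ
    run≤meets h a ρ h≤a with run h a ρ in eq
    ... | zero = z≤n
    ... | suc _ = ≤-reflexive (cong (1 ∸_) (sym (Visits⇒avoid≡0 h a ρ h≤a
      (run>0⇒Visits h a ρ (subst (0 <_) (sym eq) (s≤s z≤n))))))

    module _ {x} (bound : ∀ a → n₀ ≤ a → ∀ s d L → ∫ L (meets s a k d) * suc x ≤ x * 2 ^ L) where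

      -- The first replacement costs x/(1+x) by `bound`, taken at stage `length h + L`; given it,
      -- `J` further ones cost the `J`-th power by induction.
      run-upper : ∀ J h a L → length h ≤ a → n₀ ≤ a →
        ∫ L (atLeast J ∘ run h a) * suc x ^ J ≤ x ^ J * 2 ^ L
      run-upper zero h a L _ _ = ≤-reflexive (trans (*-identityʳ _) (∫-const L 1))
      run-upper (suc J) h a L h≤a n₀≤a = begin
        ∫ L (atLeast (suc J) ∘ run h a) * (suc x * suc x ^ J) 
          ≡⟨ regroup (∫ L (atLeast (suc J) ∘ run h a)) (suc x) (suc x ^ J) ⟩
        ∫ L (atLeast (suc J) ∘ run h a) * suc x ^ J * suc x   ≤⟨ *-monoˡ-≤ (suc x) (first-witness L h) ⟩
        x ^ J * ∫ L (atLeast 1 ∘ run h a) * suc x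
          ≡⟨ *-assoc (x ^ J) (∫ L (atLeast 1 ∘ run h a)) (suc x) ⟩
        x ^ J * (∫ L (atLeast 1 ∘ run h a) * suc x)
          ≤⟨ *-monoʳ-≤ (x ^ J) (*-monoˡ-≤ (suc x) (∫-mono L λ ρ eq →
               subst (λ s → atLeast 1 (run h a ρ) ≤ meets s a k (a ∸ length h) ρ)
                 (trans (length-++ h) (cong (length h +_) eq)) (run≤meets h a ρ h≤a))) ⟩
        x ^ J * (∫ L (meets (length h + L) a k (a ∸ length h)) * suc x)
          ≤⟨ *-monoʳ-≤ (x ^ J) (bound a n₀≤a (length h + L) (a ∸ length h) L) ⟩
        x ^ J * (x * 2 ^ L) ≡⟨ swap (x ^ J) x (2 ^ L) ⟩
        x ^ suc J * 2 ^ L ∎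
        where
        open ≤-Reasoning
        regroup : ∀ c y p → c * (y * p) ≡ c * p * y
        regroup = solve-∀
        swap : ∀ p x t → p * (x * t) ≡ x * p * t
        swap = solve-∀
        -- Splits the strings according to where the first replacement happens. The new anchor is
        -- the length read, which is still at least `n₀`, so `run-upper` for `J` applies to the
        -- remaining bits.
        first-witness : ∀ L h →
          ∫ L (atLeast (suc J) ∘ run h a) * suc x ^ J ≤ x ^ J * ∫ L (atLeast 1 ∘ run h a)
        branch : ∀ L h b →
          ∫ L (atLeast (suc J) ∘ run h a ∘ (b ∷_)) * suc x ^ J ≤ x ^ J * ∫ L (atLeast 1 ∘ run h a ∘ (b ∷_))
        branch L h b with witnessed a (h ∷ʳ b) in eq
        ... | zero = first-witness L (h ∷ʳ b)
        ... | suc _ = ≤-trans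
          (run-upper J (h ∷ʳ b) (length (h ∷ʳ b)) L ≤-refl
            (≤-trans n₀≤a (witnessed⇒anchor≤length a (h ∷ʳ b) (subst (0 <_) (sym eq) (s≤s z≤n)))))
          (≤-reflexive (cong (x ^ J *_) (sym (∫-1 L))))
        first-witness zero h = z≤n
        first-witness (suc L) h = begin
          (F false + F true) * suc x ^ J              ≡⟨ *-distribʳ-+ (suc x ^ J) (F false) _ ⟩
          F false * suc x ^ J + F true * suc x ^ J    ≤⟨ +-mono-≤ (branch L h false) (branch L h true) ⟩
          x ^ J * G false + x ^ J * G true            ≡⟨ sym (*-distribˡ-+ (x ^ J) (G false) _) ⟩
          x ^ J * (G false + G true)                  ∎
          where
          F G : Bool → ℕ
          F b = ∫ L (atLeast (suc J) ∘ run h a ∘ (b ∷_))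
          G b = ∫ L (atLeast 1 ∘ run h a ∘ (b ∷_))

      -- Every enumerated string has `J` replacements, and so have its extensions. `f` is kept
      -- abstract since a program agrees with `test` only pointwise.
      test-measure : .{{_ : NonZero x}} → ∀ m f → (∀ i → f i ≡ test (suc x) m i) → MeasureLE2^- f m
      test-measure m f f≗test s L = geometric-decay x m (approx f s L) (2 ^ L) (begin
        approx f s L * suc x ^ J ≡⟨ cong (_* suc x ^ J) (countTrue≡∫ L (hit f s)) ⟩
        ∫ L (F.χ s) * suc x ^ J  ≤⟨ *-monoˡ-≤ (suc x ^ J) (∫-mono L λ τ _ → pointwise τ) ⟩
        ∫ L (atLeast J ∘ run [] n₀) * suc x ^ J ≤⟨ run-upper J [] n₀ L z≤n ≤-refl ⟩
        x ^ J * 2 ^ L ∎)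
        where
        open ≤-Reasoning
        module F = Enumeration f
        J : ℕ
        J = suc x * m
        pointwise : ∀ τ → F.χ s τ ≤ atLeast J (run [] n₀ τ)
        pointwise τ with F.χ s τ | F.χ-view s τ
        ... | _ | F.outside _ = z≤n
        ... | _ | F.inside (i , j , _ , _ , eq) = ≤-reflexive (sym (≤⇒atLeast (≤-trans
          (test-elim (suc x) m i (take j τ) (trans (sym (f≗test i)) eq))
          (subst (λ σ → run [] n₀ (take j τ) ≤ run [] n₀ σ) (take++drop≡id j τ)
            (run-mono [] n₀ (take j τ) (drop j τ))))))

-- Capturing a non-recurrent sequence

open Process

-- Since the difference `a` fails for recurrence, some shift of `Z` by a multiple of `a` lies in the
-- open set, which a long enough prefix reveals.
nonrecurrent⇒Meeting : ExcludedMiddle 0ℓ → ∀ k n₀ p Z → ¬ Recurrent k p Z →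
  Meeting (enumΠ p) k n₀ [] Z
nonrecurrent⇒Meeting em k n₀ p Z ¬rec a 1≤a
  with em {∃ λ i → i < k × InOpen (enumΠ p) (shift (a * suc i) Z)}
... | no ¬open = contradiction
  (a , 1≤a , λ { (suc i) _ i<k open′ → ¬open (i , i<k , open′) }) ¬rec
-- The prefix must be longer than `s`, as its length bounds the stages searched, and must contain
-- the `n` bits after position (i+1)a.
... | yes (i , i<k , s , n , eq) = suc s ⊔ (suc i * a + n) , λ L L₀≤L →
  let ℓ = sym (length-prefix L Z)
      slice≤L = ≤-trans (m≤n⊔m (suc s) (suc i * a + n)) L₀≤L
  in witnessed-intro (enumΠ p) k n₀ a (prefix L Z) i<k
       (subst (s <_) ℓ (≤-trans (m≤m⊔n (suc s) (suc i * a + n)) L₀≤L))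
       (subst (n ≤_) ℓ (≤-trans (m≤n+m n (suc i * a)) slice≤L))
       (trans eq (cong (suc ∘ code) (trans
         (cong (λ q → prefix n (shift q Z)) (*-comm a (suc i)))
         (sym (slice-prefix (suc i * a) n Z slice≤L)))))

theorem5p2 : ExcludedMiddle 0ℓ → (p : PR 1) → PositiveMeasureΠ01 p →
    (Z : Cantor) → MLRandom Z → MultiplyRecurrent p Z
theorem5p2 em p (r , positive) Z random (suc k′) _ with em {Recurrent (suc k′) p Z}
... | yes recurrent = recurrent
... | no ¬recurrent
  -- Saturation at 1/(kN), so that all k shifts together lose at most 1/N.
  with s₀ , L₀ , sat ← Enumeration.saturation (enumΠ p) em (suc k′ * (2 * (2 ^ r) ^ suc k′)) =
  contradiction captured (random program₂ λ m →
    test-measure e k n₀ {r} positive {pred N} bound {{nonZero}} m (level program₂ m) (λ i → correct t (m ∷ i ∷ [])))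
  where
  e : ℕ → ℕ
  e = enumΠ p
  open Enumeration e using (resolution)
  open Avoidance e r positive using (meets; meets-upper)
  k N n₀ : ℕ
  k = suc k′
  N = 2 * (2 ^ r) ^ k
  -- The successor makes the initial anchor positive, as a recurrence step must be.
  n₀ = suc (resolution s₀)
  2≤N : 2 ≤ N
  2≤N = *-monoʳ-≤ 2 (m^n>0 (2 ^ r) {{m^n≢0 2 r}} k)
  nonZero : NonZero (pred N)
  -- The halving estimate divides by x = N - 1, hence the need for N ≥ 2.
  nonZero = >-nonZero (∸-monoˡ-≤ 1 2≤N)
  N≡ : suc (pred N) ≡ N
  N≡ = suc-pred N {{>-nonZero (≤-trans (s≤s z≤n) 2≤N)}}
  bound : ∀ a → n₀ ≤ a → ∀ s d L → ∫ L (meets s a k d) * suc (pred N) ≤ pred N * 2 ^ L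
  bound a n₀≤a s d L = subst (λ y → ∫ L (meets s a k d) * y ≤ pred N * 2 ^ L) (sym N≡)
    (meets-upper k {s₀} {L₀} s (sat s) (<⇒≤ n₀≤a) d L)
  t : PrimRec _
  t = PrimRec₂.vector (test-primRec e k n₀ (unary (p realises λ { (_ ∷ []) → refl })) (suc (pred N)))
  program₂ : PR 2
  program₂ = program t
  captured : ∀ m → InOpen (level program₂ m) Z
  captured m
    with M , le ← run-unbounded e k n₀ (suc (pred N) * m) [] Z n₀ (s≤s z≤n)
                    (nonrecurrent⇒Meeting em k n₀ p Z ¬recurrent) =
    -- The stage is the code of the very prefix that it enumerates.
    code (prefix M Z) , M , trans (correct t (m ∷ code (prefix M Z) ∷ []))
      (test-intro e k n₀ (suc (pred N)) m (prefix M Z) le)
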